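{- Let $P=(V,\le)$ be a poset, $G$ its incomparability graph, $X\subseteq V$ and $r\in\mathbb N$. (a) If $X$ is an initial segment (respectively a final segment, respectively an order convex subset) of $P$, then $B_G(X,r)$ is an initial segment (respectively a final segment, respectively an order convex subset) of $P$. In particular, for all $x\in V$ and $r\in\mathbb N$, $B_G(x,r)$ is order convex. (b) If $X$ is order convex, then the graph induced by $G$ on $B_G(X,r)$ is an isometric subgraph of $G$. In particular, if $X$ is included in a connected component of $G$, then the graph induced by $G$ on $B_G(X,r)$ is connected.
   Context: $\mathbb N$ is the set of nonnegative integers. The incomparability graph $G$ of $P=(V,\le)$ has vertex set $V$ and edges the pairs of incomparable elements. $d_G(x,y)$ is the length of a shortest path from $x$ to $y$ in $G$ ($\infty$ if none). $B_G(x,r):=\{y\in V: d_G(x,y)\le r\}$ and $B_G(X,r):=\{v\in V: d_G(v,x)\le r\text{ for some }x\in X\}$. A subset $I\subseteq V$ is an initial segment if $x\in V$, $y\in I$ and $x\le y$ imply $x\in I$; final segments are defined dually. $X\subseteq V$ is order convex if $x\le z\le y$ with $x,y\in X$ implies $z\in X$. The graph $G'$ induced by $G$ on $A\subseteq V$ is an isometric subgraph of $G$ if $d_{G'}(x,y)=d_G(x,y)$ for all $x,y\in A$.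
   Formalization: Part (b) is proved for r ≥ 1 only; for r = 0 it is false: if a < b is the only strict relation on V = {a,b,z} and X = {a,b}, then X is order convex and lies in one component, but B_G(X,0) = X induces no edge while d_G(a,b) = 2. -}

module Defs where

open import Data.Fin.Base using (Fin; zero; suc; inject₁; fromℕ)
open import Data.Nat.Base as ℕ using (ℕ)
open import Data.Product.Base using (Σ; ∃; ∃-syntax; _×_; _,_; proj₁; proj₂; swap)
open import Function.Definitions using (Injective)
open import Level using (Level; _⊔_; 0ℓ) renaming (suc to lsuc)
open import Relation.Binary.Bundles using (Poset; Setoid)
open import Relation.Binary.Core using (Rel)
import Relation.Binary.Construct.Add.Supremum.NonStrict as Supremum
import Relation.Binary.Construct.On as On
open import Relation.Binary.Definitions using (Symmetric; Irreflexive; _Respects₂_)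
open import Relation.Binary.PropositionalEquality.Core using (_≡_)
open import Relation.Nullary.Construct.Add.Supremum using (_⁺; [_]; ⊤⁺)
open import Relation.Nullary.Negation.Core using (¬_)
open import Relation.Unary using (Pred)

private
  variable
    c ℓ₁ ℓ₂ ℓ v ℓᵥ ℓₑ : Level

ℕ∞ : Set
ℕ∞ = ℕ ⁺

infix 4 _≤∞_

_≤∞_ : Rel ℕ∞ 0ℓ
_≤∞_ = Supremum._≤⁺_ ℕ._≤_

record Graph v ℓᵥ ℓₑ : Set (lsuc (v ⊔ ℓᵥ ⊔ ℓₑ)) where
  field
    vertices : Setoid v ℓᵥ

  open Setoid vertices public using (_≈_) renaming (Carrier to Vertex)

  field
    Adj        : Rel Vertex ℓₑ
    adj-sym    : Symmetric Adj
    adj-irrefl : Irreflexive _≈_ Adj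
    adj-resp-≈ : Adj Respects₂ _≈_

module _ (G : Graph v ℓᵥ ℓₑ) where
  open Graph G

  record Path (x y : Vertex) (n : ℕ) : Set (v ⊔ ℓᵥ ⊔ ℓₑ) where
    field
      vertex   : Fin (ℕ.suc n) → Vertex
      source   : vertex zero ≈ x
      target   : vertex (fromℕ n) ≈ y
      edges    : ∀ (i : Fin n) → Adj (vertex (inject₁ i)) (vertex (suc i))
      distinct : Injective _≡_ _≈_ vertex

  -- The distance is given by its graph: classically, for all x and y there
  -- is exactly one d with IsDistance x y d, but it cannot be computed.
  IsDistance : Vertex → Vertex → ℕ∞ → Set (v ⊔ ℓᵥ ⊔ ℓₑ)
  IsDistance x y [ n ] = Path x y n × (∀ m → Path x y m → n ℕ.≤ m)
  IsDistance x y ⊤⁺    = ∀ m → ¬ Path x y m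

  DistanceAtMost : Vertex → Vertex → ℕ → Set (v ⊔ ℓᵥ ⊔ ℓₑ)
  DistanceAtMost x y r = ∃[ d ] IsDistance x y d × d ≤∞ [ r ]

  Ball : Vertex → ℕ → Pred Vertex (v ⊔ ℓᵥ ⊔ ℓₑ)
  Ball x r y = DistanceAtMost x y r

  BallAround : Pred Vertex ℓ → ℕ → Pred Vertex (v ⊔ ℓᵥ ⊔ ℓₑ ⊔ ℓ)
  BallAround X r y = ∃[ x ] X x × DistanceAtMost y x r

  Component : Vertex → Pred Vertex (v ⊔ ℓᵥ ⊔ ℓₑ)
  Component x y = ∃[ n ] Path x y n

  -- The empty graph counts as connected.
  Connected : Set (v ⊔ ℓᵥ ⊔ ℓₑ)
  Connected = ∀ x y → Component x y

  Induced : Pred Vertex ℓ → Graph (v ⊔ ℓ) ℓᵥ ℓₑ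
  Induced A = record
    { vertices   = On.setoid {B = Σ Vertex A} vertices proj₁
    ; Adj        = λ x y → Adj (proj₁ x) (proj₁ y)
    ; adj-sym    = adj-sym
    ; adj-irrefl = adj-irrefl
    ; adj-resp-≈ = proj₁ adj-resp-≈ , proj₂ adj-resp-≈
    }

IsIsometric : (G : Graph v ℓᵥ ℓₑ) → Pred (Graph.Vertex G) ℓ → Set (v ⊔ ℓᵥ ⊔ ℓₑ ⊔ ℓ)
IsIsometric G A = ∀ (x y : Σ (Graph.Vertex G) A) →
  ∃[ d ] IsDistance (Induced G A) x y d × IsDistance G (proj₁ x) (proj₁ y) d

-- Subsets of P are arbitrary predicates; each of the three conditions below
-- implies that the predicate respects _≈_.
module _ (P : Poset c ℓ₁ ℓ₂) where
  open Poset P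

  IsInitialSegment : Pred Carrier ℓ → Set (c ⊔ ℓ₂ ⊔ ℓ)
  IsInitialSegment I = ∀ {x y} → I y → x ≤ y → I x

  IsFinalSegment : Pred Carrier ℓ → Set (c ⊔ ℓ₂ ⊔ ℓ)
  IsFinalSegment F = ∀ {x y} → F x → x ≤ y → F y

  IsOrderConvex : Pred Carrier ℓ → Set (c ⊔ ℓ₂ ⊔ ℓ)
  IsOrderConvex X = ∀ {x y z} → X x → X y → x ≤ z → z ≤ y → X z

  Incomparable : Rel Carrier ℓ₂
  Incomparable x y = x ≰ y × y ≰ x

  IncomparabilityGraph : Graph c ℓ₁ ℓ₂
  IncomparabilityGraph = record
    { vertices   = Eq.setoid
    ; Adj        = Incomparable
    ; adj-sym    = swap
    ; adj-irrefl = λ x≈y x∥y → proj₁ x∥y (reflexive x≈y)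
    ; adj-resp-≈ =
        (λ y≈z (x≰y , y≰x) → (λ x≤z → x≰y (≤-respʳ-≈ (Eq.sym y≈z) x≤z))
                            , (λ z≤x → y≰x (≤-respˡ-≈ (Eq.sym y≈z) z≤x)))
      , (λ y≈z (y≰x , x≰y) → (λ z≤x → y≰x (≤-respˡ-≈ (Eq.sym y≈z) z≤x))
                            , (λ x≤z → x≰y (≤-respʳ-≈ (Eq.sym y≈z) x≤z)))
    }

{-# OPTIONS --safe #-}

-- Everything rests on one observation: if x ≤ y and y is joined to z by a walk
-- with at most n edges, then either x ≤ z or x is joined to z by such a walk,
-- because the first edge leaving y can be taken from x unless its end lies
-- above x. This gives (a).
--
-- For (b), let B = B(X,r) with r ≥ 1, and call an element of B inner if all its
-- neighbours lie in B. Every element of B is inner or has an inner neighbour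
-- (the next vertex on a walk to X). Together with order convexity this
-- suffices: given a walk x, x₁, x₂, …, y between elements x ≤ y of B, either it
-- can be shortened, or x ≤ x₂ and x₁ lies in B or can be exchanged for an inner
-- neighbour of x or y.
module Submission where

open import Axiom.ExcludedMiddle using (ExcludedMiddle)
open import Data.Fin.Base using (Fin; zero; suc; inject₁; fromℕ)
open import Data.Nat.Base using (ℕ; zero; suc; _+_; _≤_; z≤n; s≤s)
open import Data.Nat.Properties
  using (≤-refl; ≤-trans; ≤-antisym; ≤-pred; ≰⇒>; n≤1+n; m≤n+m; 1+n≰n)
open import Data.Product.Base using (_×_; ∃-syntax; _,_; proj₁; proj₂)
open import Data.Sum.Base using (_⊎_; inj₁; inj₂; map₂; swap)
open import Function.Base using (flip; _∘_)
open import Function.Definitions using (Injective)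
open import Level using (Level; _⊔_; Lift; lift; lower)
open import Relation.Binary.Bundles using (Poset; Setoid)
open import Relation.Binary.Construct.Add.Supremum.NonStrict using ([_])
import Relation.Binary.Construct.Flip.EqAndOrd as Flip
open import Relation.Binary.Core using (Rel)
open import Relation.Binary.PropositionalEquality
  using (_≡_; refl; cong; subst; sym)
open import Relation.Binary.Structures using (IsPartialOrder)
open import Relation.Nullary using (¬_; yes; no; contradiction)
open import Relation.Nullary.Construct.Add.Supremum using ([_]; ⊤⁺)
open import Relation.Nullary.Decidable using (map′)
open import Relation.Unary using (Pred; _⊆_)
open import Defs

private
  variable
    a b c ℓ₁ ℓ₂ ℓ v ℓᵥ ℓₑ : Level

-- Decides `A` through its lift, so that one instance of excluded middle serves all smaller universe
-- levels.
excludedMiddle-lower : ∀ b → ExcludedMiddle (a ⊔ b) → ExcludedMiddle a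
excludedMiddle-lower b em {A} = map′ lower lift (em {Lift b A})

-- Walks, shortest paths and distance.

module _ (G : Graph v ℓᵥ ℓₑ) where
  open Graph G

  -- The index bounds the number of edges; it need not be attained.
  data Walk : Vertex → Vertex → ℕ → Set (v ⊔ ℓᵥ ⊔ ℓₑ) where
    nil  : ∀ {x y n} → x ≈ y → Walk x y n
    cons : ∀ {x y z n} → Adj x z → Walk z y n → Walk x y (suc n)

module _ {G : Graph v ℓᵥ ℓₑ} where
  open Graph G
  private module V = Setoid vertices

  weaken : ∀ {x y m n} → m ≤ n → Walk G x y m → Walk G x y n
  weaken m≤n       (nil x≈y)  = nil x≈y
  weaken (s≤s m≤n) (cons e w) = cons e (weaken m≤n w)

  walk-respˡ : ∀ {x x′ y n} → x ≈ x′ → Walk G x y n → Walk G x′ y n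
  walk-respˡ x≈x′ (nil x≈y)  = nil (V.trans (V.sym x≈x′) x≈y)
  walk-respˡ x≈x′ (cons e w) = cons (proj₂ adj-resp-≈ x≈x′ e) w

  snoc : ∀ {x y z n} → Walk G x y n → Adj y z → Walk G x z (suc n)
  snoc (nil x≈y)  e = cons (proj₂ adj-resp-≈ (V.sym x≈y) e) (nil V.refl)
  snoc (cons f w) e = cons f (snoc w e)

  reverse : ∀ {x y n} → Walk G x y n → Walk G y x n
  reverse (nil x≈y)  = nil (V.sym x≈y)
  reverse (cons e w) = snoc (reverse w) (adj-sym e)

  _++_ : ∀ {x y z m n} → Walk G x y m → Walk G y z n → Walk G x z (m + n)
  _++_ {m = m} {n} (nil x≈y) w′ = weaken (m≤n+m n m) (walk-respˡ (V.sym x≈y) w′)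
  cons e w ++ w′                = cons e (w ++ w′)

  vertices⇒walk : ∀ {y} n (u : Fin (suc n) → Vertex) → u (fromℕ n) ≈ y →
                  (∀ i → Adj (u (inject₁ i)) (u (suc i))) → Walk G (u zero) y n
  vertices⇒walk zero    u target edges = nil target
  vertices⇒walk (suc n) u target edges =
    cons (edges zero) (vertices⇒walk n (u ∘ suc) target (edges ∘ suc))

  path⇒walk : ∀ {x y n} → Path G x y n → Walk G x y n
  path⇒walk {n = n} p = walk-respˡ source (vertices⇒walk n vertex target edges)
    where open Path p

  visit : ∀ {x y n} → Walk G x y n → Fin (suc n) → Vertex
  -- A `nil` with slack in its bound stands still at `x`; minimality of the bound excludes this
  -- wherever edges or injectivity matter.
  visit {x} (nil _)    _       = x
  visit {x} (cons _ _) zero    = x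
  visit     (cons _ w) (suc i) = visit w i

  visit-zero : ∀ {x y n} (w : Walk G x y n) → visit w zero ≡ x
  visit-zero (nil _)    = refl
  visit-zero (cons _ _) = refl

  visit-last : ∀ {x y n} (w : Walk G x y n) → visit w (fromℕ n) ≈ y
  visit-last (nil x≈y)  = x≈y
  visit-last (cons _ w) = visit-last w

  drop : ∀ {x y n} (w : Walk G x y n) i → Walk G (visit w i) y n
  drop (nil x≈y)  _       = nil x≈y
  drop (cons e w) zero    = cons e w
  drop (cons e w) (suc i) = weaken (n≤1+n _) (drop w i)

  IsShortest : Vertex → Vertex → ℕ → Set (v ⊔ ℓᵥ ⊔ ℓₑ)
  IsShortest x y n = ∀ m → Walk G x y m → n ≤ m

  shortest-tail : ∀ {x y z n} → Adj x z → IsShortest x y (suc n) → IsShortest z y n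
  shortest-tail e short m w = ≤-pred (short (suc m) (cons e w))

  visit-edges : ∀ {x y n} (w : Walk G x y n) → IsShortest x y n →
                ∀ i → Adj (visit w (inject₁ i)) (visit w (suc i))
  visit-edges {n = suc n} (nil x≈y) short i = contradiction (short 0 (nil x≈y)) λ ()
  visit-edges (cons {x} e w) short zero = subst (Adj x) (sym (visit-zero w)) e
  visit-edges (cons e w) short (suc i) = visit-edges w (shortest-tail e short) i

  -- If the start recurred later, dropping everything before the recurrence would give a walk with a
  -- smaller bound.
  visit-injective : ∀ {x y n} (w : Walk G x y n) → IsShortest x y n →
                    Injective _≡_ _≈_ (visit w)
  visit-injective w short {zero} {zero} _ = refl
  visit-injective {n = suc n} (nil x≈y) short _ =
    contradiction (short 0 (nil x≈y)) λ ()
  visit-injective (cons e w) short {zero} {suc j} x≈u =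
    contradiction (short _ (walk-respˡ (V.sym x≈u) (drop w j))) 1+n≰n
  visit-injective (cons e w) short {suc i} {zero} u≈x =
    contradiction (short _ (walk-respˡ u≈x (drop w i))) 1+n≰n
  visit-injective (cons e w) short {suc i} {suc j} eq =
    cong suc (visit-injective w (shortest-tail e short) eq)

  shortest⇒path : ∀ {x y n} → Walk G x y n → IsShortest x y n → Path G x y n
  shortest⇒path w short = record
    { vertex   = visit w
    ; source   = V.reflexive (visit-zero w)
    ; target   = visit-last w
    ; edges    = visit-edges w short
    ; distinct = visit-injective w short
    }

  module _ (em : ExcludedMiddle (v ⊔ ℓᵥ ⊔ ℓₑ)) where

    -- Lower the bound by one as long as excluded middle provides a walk. Bounds are monotone, so
    -- the first failure rules out all smaller bounds.
    shortest : ∀ {x y} n → Walk G x y n →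
               ∃[ d ] d ≤ n × Walk G x y d × IsShortest x y d
    shortest zero w = 0 , z≤n , w , λ _ _ → z≤n
    shortest {x} {y} (suc n) w with em {Walk G x y n}
    ... | yes w′ = let d , d≤n , rest = shortest n w′
                   in  d , ≤-trans d≤n (n≤1+n n) , rest
    ... | no ¬w′ = suc n , ≤-refl , w , λ m u →
      ≰⇒> λ m≤n → ¬w′ (weaken m≤n u)

    walk⇒distance : ∀ {x y} n → Walk G x y n →
                    ∃[ d ] d ≤ n × IsDistance G x y [ d ]
    walk⇒distance n w =
      let d , d≤n , u , short = shortest n w
      in  d , d≤n , shortest⇒path u short , λ m → short m ∘ path⇒walk

    walk⇒distanceAtMost : ∀ {x y n} → Walk G x y n → DistanceAtMost G x y n
    walk⇒distanceAtMost {n = n} w =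
      let d , d≤n , dist = walk⇒distance n w in [ d ] , dist , [ d≤n ]

    -- `IsDistance` compares with paths only, but every walk yields a path with no larger bound.
    distance-minimal : ∀ {x y d} → IsDistance G x y [ d ] → IsShortest x y d
    distance-minimal (_ , min) m w =
      let d′ , d′≤m , path , _ = walk⇒distance m w in ≤-trans (min d′ path) d′≤m

  distanceAtMost⇒walk : ∀ {x y n} → DistanceAtMost G x y n → Walk G x y n
  distanceAtMost⇒walk ([ d ] , (path , _) , [ d≤n ]) = weaken d≤n (path⇒walk path)

-- Induced subgraphs and isometry.

induced-walk⇒walk : ∀ {G : Graph v ℓᵥ ℓₑ} {A : Pred (Graph.Vertex G) ℓ} {x y n} →
                    Walk (Induced G A) x y n → Walk G (proj₁ x) (proj₁ y) n
induced-walk⇒walk (nil x≈y)  = nil x≈y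
induced-walk⇒walk (cons e w) = cons e (induced-walk⇒walk w)

-- The walk inside `A` may visit other vertices than the given one; only the ends and the bound are
-- kept.
WalksRestrict : (G : Graph v ℓᵥ ℓₑ) → Pred (Graph.Vertex G) ℓ → Set (v ⊔ ℓᵥ ⊔ ℓₑ ⊔ ℓ)
WalksRestrict G A = ∀ {x y} (x∈A : A x) (y∈A : A y) n →
  Walk G x y n → Walk (Induced G A) (x , x∈A) (y , y∈A) n

walksRestrict⇒isometric :
  ∀ {G : Graph v ℓᵥ ℓₑ} {A : Pred (Graph.Vertex G) ℓ} →
  ExcludedMiddle (v ⊔ ℓᵥ ⊔ ℓₑ ⊔ ℓ) → WalksRestrict G A → IsIsometric G A
walksRestrict⇒isometric {v} {ℓᵥ} {ℓₑ} {ℓ} {G} {A} em restrict (x , x∈A) (y , y∈A)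
  with excludedMiddle-lower ℓ em {∃[ n ] Walk G x y n}
... | no ¬w = ⊤⁺ , (λ m → ¬w ∘ (m ,_) ∘ induced-walk⇒walk ∘ path⇒walk)
                 , (λ m → ¬w ∘ (m ,_) ∘ path⇒walk)
... | yes (n , w)
  with d , _ , dist  ← walk⇒distance (excludedMiddle-lower ℓ em) n w
  with e , e≤d , dist′ ← walk⇒distance em d
                           (restrict x∈A y∈A d (path⇒walk (proj₁ dist)))
  -- The restricted walk gives `e ≤ d`; conversely, a path in the induced graph is also a walk in
  -- `G`.
  with refl ← ≤-antisym e≤d
                (distance-minimal (excludedMiddle-lower ℓ em) dist e
                  (induced-walk⇒walk (path⇒walk (proj₁ dist′))))
  = [ d ] , dist′ , dist

-- Incomparability graphs, up to reversal of the order.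

-- The axioms are those of an incomparability graph, stated so that the order
-- can be reversed without changing the graph.
record IsIncomparabilityGraphOf (G : Graph v ℓᵥ ℓₑ) (_≼_ : Rel (Graph.Vertex G) ℓ)
       : Set (v ⊔ ℓᵥ ⊔ ℓₑ ⊔ ℓ) where
  open Graph G
  field
    isPartialOrder : IsPartialOrder _≈_ _≼_
    adj⇒⋠          : ∀ {x y} → Adj x y → ¬ x ≼ y
    compare        : ∀ x y → Adj x y ⊎ x ≼ y ⊎ y ≼ x

  open IsPartialOrder isPartialOrder public
    using (module Eq; trans; antisym; ≤-respʳ-≈)

  adj⇒⋡ : ∀ {x y} → Adj x y → ¬ y ≼ x
  adj⇒⋡ = adj⇒⋠ ∘ adj-sym

  walk-below : ∀ {x y z n} → x ≼ y → Walk G y z n → x ≼ z ⊎ Walk G x z n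
  walk-below x≼y (nil y≈z) = inj₁ (≤-respʳ-≈ y≈z x≼y)
  walk-below {x} x≼y (cons {z = u} e w) with compare x u
  ... | inj₁ x∥u        = inj₂ (cons x∥u w)
  ... | inj₂ (inj₂ u≼x) = contradiction (trans u≼x x≼y) (adj⇒⋡ e)
  -- Now `x` lies below `u` as it did below `y`, so the argument repeats along the rest of the walk.
  ... | inj₂ (inj₁ x≼u) with walk-below x≼u w
  ...   | inj₁ x≼z = inj₁ x≼z
  ...   | inj₂ w′  = inj₂ (weaken (n≤1+n _) w′)

opposite : ∀ {G : Graph v ℓᵥ ℓₑ} {_≼_ : Rel (Graph.Vertex G) ℓ} →
           IsIncomparabilityGraphOf G _≼_ → IsIncomparabilityGraphOf G (flip _≼_)
opposite {G = G} inc = record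
  { isPartialOrder = Flip.isPartialOrder isPartialOrder
  ; adj⇒⋠          = adj⇒⋡
  ; compare        = λ x y → map₂ swap (compare x y)
  }
  where open IsIncomparabilityGraphOf inc

-- Moving walks into a convex set.

module _ (G : Graph v ℓᵥ ℓₑ) (B : Pred (Graph.Vertex G) b) where
  open Graph G

  IsInner : Pred Vertex (v ⊔ ℓₑ ⊔ b)
  IsInner x = ∀ {z} → Adj x z → B z

  HasInnerNeighbour : Pred Vertex (v ⊔ ℓₑ ⊔ b)
  HasInnerNeighbour x = ∃[ a ] B a × Adj x a × IsInner a

module _ {G : Graph v ℓᵥ ℓₑ} {_≼_ : Rel (Graph.Vertex G) ℓ}
         (inc : IsIncomparabilityGraphOf G _≼_)
         {B : Pred (Graph.Vertex G) b}
         (inner : ∀ {x} → B x → IsInner G B x ⊎ HasInnerNeighbour G B x) where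
  open Graph G
  open IsIncomparabilityGraphOf inc

  -- The second outcome is half of what convexity needs to put `u` itself in `B`. If an inner
  -- neighbour `a` of `x` lies above `u`, it is incomparable to `y` and can replace `u`.
  replace-middle : ∀ {x u y} → B x → x ≼ y → Adj x u → Adj u y →
                   (∃[ z ] B z × Adj x z × Adj z y) ⊎ (∃[ z ] B z × z ≼ u)
  replace-middle {u = u} x∈B x≼y x∥u u∥y with inner x∈B
  ... | inj₁ x-inner = inj₁ (u , x-inner x∥u , x∥u , u∥y)
  ... | inj₂ (a , a∈B , x∥a , a-inner) with compare a u
  ...   | inj₁ a∥u        = inj₁ (u , a-inner a∥u , x∥u , u∥y)
  ...   | inj₂ (inj₁ a≼u) = inj₂ (a , a∈B , a≼u)
  ...   | inj₂ (inj₂ u≼a) with compare a _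
  ...     | inj₁ a∥y        = inj₁ (a , a∈B , x∥a , a∥y)
  ...     | inj₂ (inj₁ a≼y) = contradiction (trans u≼a a≼y) (adj⇒⋠ u∥y)
  ...     | inj₂ (inj₂ y≼a) = contradiction (trans x≼y y≼a) (adj⇒⋠ x∥a)

module _ {G : Graph v ℓᵥ ℓₑ} {_≼_ : Rel (Graph.Vertex G) ℓ}
         (inc : IsIncomparabilityGraphOf G _≼_)
         {B : Pred (Graph.Vertex G) b}
         (convex : ∀ {x y z} → B x → B y → x ≼ z → z ≼ y → B z)
         (inner : ∀ {x} → B x → IsInner G B x ⊎ HasInnerNeighbour G B x) where
  open Graph G
  open IsIncomparabilityGraphOf inc

  common-neighbour : ∀ {x u y} → B x → B y → x ≼ y → Adj x u → Adj u y →
                     ∃[ z ] B z × Adj x z × Adj z y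
  common-neighbour x∈B y∈B x≼y x∥u u∥y
    with replace-middle inc inner x∈B x≼y x∥u u∥y
       -- Reversing the order exchanges the roles of `x` and `y` and yields an element of `B` above
       -- `u`.
       | replace-middle (opposite inc) inner y∈B x≼y (adj-sym u∥y) (adj-sym x∥u)
  ... | inj₁ found | _ = found
  ... | inj₂ _ | inj₁ (z , z∈B , y∥z , z∥x) = z , z∈B , adj-sym z∥x , adj-sym y∥z
  ... | inj₂ (a , a∈B , a≼u) | inj₂ (b , b∈B , u≼b) =
    _ , convex a∈B b∈B a≼u u≼b , x∥u , u∥y

  -- The given walk has bound `n + 2`: either one edge is saved, or the first vertex after `x` is
  -- made to lie in `B` without raising the bound.
  first-step : ∀ {x u t y n} → B x → B y → x ≼ y →
               Adj x u → Adj u t → Walk G t y n →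
               Walk G x y (suc n) ⊎ (∃[ z ] B z × Adj x z × Walk G z y (suc n))
  first-step {x} {u} {t} {y} x∈B y∈B x≼y x∥u u∥t w with compare x t
  ... | inj₁ x∥t = inj₁ (cons x∥t w)
  -- In the reversed order, `x` can take over the walk that leaves `t`, unless `y ≼ x`, which makes
  -- the two ends equal.
  ... | inj₂ (inj₂ t≼x) with IsIncomparabilityGraphOf.walk-below (opposite inc) t≼x w
  ...   | inj₁ y≼x = inj₁ (nil (antisym x≼y y≼x))
  ...   | inj₂ w′  = inj₁ (weaken (n≤1+n _) w′)
  first-step {x} {u} {t} {y} x∈B y∈B x≼y x∥u u∥t w | inj₂ (inj₁ x≼t)
    with compare u y
  ... | inj₂ (inj₂ y≼u) = contradiction (trans x≼y y≼u) (adj⇒⋠ x∥u)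
  ... | inj₁ u∥y =
    let z , z∈B , x∥z , z∥y = common-neighbour x∈B y∈B x≼y x∥u u∥y
    in  inj₂ (z , z∈B , x∥z , cons z∥y (nil Eq.refl))
  -- Here `y` already bounds `u` from above within `B`, so only a lower bound is sought. The far end
  -- passed to `replace-middle` is `t`, which may lie outside `B`.
  ... | inj₂ (inj₁ u≼y) with replace-middle inc inner x∈B x≼t x∥u u∥t
  ...   | inj₁ (z , z∈B , x∥z , z∥t) = inj₂ (z , z∈B , x∥z , cons z∥t w)
  ...   | inj₂ (z , z∈B , z≼u)       =
    inj₂ (u , convex z∈B y∈B z≼u u≼y , x∥u , cons u∥t w)

module _ {G : Graph v ℓᵥ ℓₑ} {_≼_ : Rel (Graph.Vertex G) ℓ}
         (inc : IsIncomparabilityGraphOf G _≼_)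
         {B : Pred (Graph.Vertex G) b}
         (convex : ∀ {x y z} → B x → B y → x ≼ z → z ≼ y → B z)
         (inner : ∀ {x} → B x → IsInner G B x ⊎ HasInnerNeighbour G B x) where
  open Graph G
  open IsIncomparabilityGraphOf inc

  -- Induction on the bound: either the same ends are joined by a shorter walk, or the walk advances
  -- to a vertex of `B`.
  convex⇒walksRestrict : WalksRestrict G B
  convex⇒walksRestrict x∈B y∈B n (nil x≈y) = nil x≈y
  convex⇒walksRestrict {y = y} x∈B y∈B (suc n) (cons e (nil z≈y)) =
    -- The edge is made to end at `y` itself, whose membership in `B` is at hand, instead of at the
    -- equal `z`.
    cons {z = y , y∈B} (proj₁ adj-resp-≈ z≈y e) (nil Eq.refl)
  convex⇒walksRestrict {x} {y} x∈B y∈B (suc (suc n)) (cons x∥u (cons u∥t w)) =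
    conclude (suc n) step
    where
    Step : ℕ → Set _
    Step m = Walk G x y m ⊎ (∃[ z ] B z × Adj x z × Walk G z y m)

    -- The bound is a separate argument for the sake of the termination checker.
    conclude : ∀ m → Step m → Walk (Induced G B) (x , x∈B) (y , y∈B) (suc m)
    conclude m (inj₁ w′) = weaken (n≤1+n _) (convex⇒walksRestrict x∈B y∈B m w′)
    conclude m (inj₂ (z , z∈B , x∥z , w′)) =
      cons x∥z (convex⇒walksRestrict z∈B y∈B m w′)

    step : Step (suc n)
    step with compare x y
    ... | inj₁ x∥y        = inj₁ (cons x∥y (nil Eq.refl))
    ... | inj₂ (inj₁ x≼y) = first-step inc convex inner x∈B y∈B x≼y x∥u u∥t w
    -- The order is reversed rather than the walk, so the walk still starts at `x`.
    ... | inj₂ (inj₂ y≼x) =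
      first-step (opposite inc) (λ p q z≼p q≼z → convex q p q≼z z≼p) inner
                 x∈B y∈B y≼x x∥u u∥t w

-- Balls in the incomparability graph of a poset.

incomparabilityGraph : (P : Poset c ℓ₁ ℓ₂) → ExcludedMiddle ℓ₂ →
  IsIncomparabilityGraphOf (IncomparabilityGraph P) (Poset._≤_ P)
incomparabilityGraph P em = record
  { isPartialOrder = isPartialOrder
  ; adj⇒⋠          = proj₁
  ; compare        = compare
  }
  where
  open Poset P using (isPartialOrder) renaming (_≤_ to _≼_)
  compare : ∀ x y → Incomparable P x y ⊎ x ≼ y ⊎ y ≼ x
  compare x y with em {x ≼ y} | em {y ≼ x}
  ... | yes x≼y | _       = inj₂ (inj₁ x≼y)
  ... | no _    | yes y≼x = inj₂ (inj₂ y≼x)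
  ... | no x⋠y  | no y⋠x  = inj₁ (x⋠y , y⋠x)

module _ (P : Poset c ℓ₁ ℓ₂) (em : ExcludedMiddle (c ⊔ ℓ₁ ⊔ ℓ₂)) where
  open Poset P using (Carrier; module Eq; reflexive; trans) renaming (_≤_ to _≼_)

  private
    G = IncomparabilityGraph P
    inc = incomparabilityGraph P (excludedMiddle-lower (c ⊔ ℓ₁) em)

  open IsIncomparabilityGraphOf inc using (walk-below)
  open IsIncomparabilityGraphOf (opposite inc) using ()
    renaming (walk-below to walk-above)

  module _ {X : Pred Carrier ℓ} {r : ℕ} where

    walk⇒ball : ∀ {x y} → X x → Walk G y x r → BallAround G X r y
    walk⇒ball x∈X w = _ , x∈X , walk⇒distanceAtMost em w

    ball-initial : IsInitialSegment P X → IsInitialSegment P (BallAround G X r)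
    ball-initial initial (a , a∈X , d) x≼y
      with walk-below x≼y (distanceAtMost⇒walk d)
    ... | inj₁ x≼a = walk⇒ball (initial a∈X x≼a) (nil Eq.refl)
    ... | inj₂ w   = walk⇒ball a∈X w

    ball-final : IsFinalSegment P X → IsFinalSegment P (BallAround G X r)
    ball-final final (a , a∈X , d) x≼y
      with walk-above x≼y (distanceAtMost⇒walk d)
    ... | inj₁ a≼y = walk⇒ball (final a∈X a≼y) (nil Eq.refl)
    ... | inj₂ w   = walk⇒ball a∈X w

    -- The element `z` inherits the walk of `x` or that of `y`, unless it lies between `a` and `b`
    -- and hence in `X`.
    ball-convex : IsOrderConvex P X → IsOrderConvex P (BallAround G X r)
    ball-convex convex (a , a∈X , d) (b , b∈X , e) x≼z z≼y
      with walk-above x≼z (distanceAtMost⇒walk d)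
         | walk-below z≼y (distanceAtMost⇒walk e)
    ... | inj₂ w   | _        = walk⇒ball a∈X w
    ... | inj₁ _   | inj₂ w   = walk⇒ball b∈X w
    ... | inj₁ a≼z | inj₁ z≼b = walk⇒ball (convex a∈X b∈X a≼z z≼b) (nil Eq.refl)

  -- Elements of `X` are inner because the radius is at least 1. Otherwise the next vertex towards
  -- `X` has a walk to `X` with one edge to spare for its neighbours. With radius 0 this fails for
  -- an element of `X` whose neighbours all lie outside `X`, if it has any.
  ball-inner : ∀ {X : Pred Carrier ℓ} {r x} → 1 ≤ r → BallAround G X r x →
    IsInner G (BallAround G X r) x ⊎ HasInnerNeighbour G (BallAround G X r) x
  ball-inner {r = suc r} _ (a , a∈X , d) with distanceAtMost⇒walk d
  ... | nil x≈a  = inj₁ λ x∥z → walk⇒ball a∈X (cons (adj-sym x∥z) (nil x≈a))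
    where open Graph G
  ... | cons e w = inj₂
    ( _ , walk⇒ball a∈X (weaken (n≤1+n r) w) , e
    , λ u∥z → walk⇒ball a∈X (cons (Graph.adj-sym G u∥z) w) )

  singleton-convex : ∀ x → IsOrderConvex P (Eq._≈ x)
  singleton-convex x y≈x z≈x y≼u u≼z = Poset.antisym P
    (trans u≼z (reflexive z≈x)) (trans (reflexive (Eq.sym y≈x)) y≼u)

  -- A ball around a point is the ball around its equality class; walks are reversed because the two
  -- notions measure distance in opposite directions.
  ball-point-convex : ∀ x s → IsOrderConvex P (Ball G x s)
  ball-point-convex x s p q y≼z z≼u =
    from (ball-convex (singleton-convex x) (to p) (to q) y≼z z≼u)
    where
    to : Ball G x s ⊆ BallAround G (Eq._≈ x) s
    to d = walk⇒ball Eq.refl (reverse (distanceAtMost⇒walk d))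
    from : BallAround G (Eq._≈ x) s ⊆ Ball G x s
    from (a , a≈x , d) =
      walk⇒distanceAtMost em (walk-respˡ a≈x (reverse (distanceAtMost⇒walk d)))

theorem7 : ∀ {c ℓ₁ ℓ₂ ℓ : Level} → ExcludedMiddle (c ⊔ ℓ₁ ⊔ ℓ₂ ⊔ ℓ) →
    (P : Poset c ℓ₁ ℓ₂) (X : Pred (Poset.Carrier P) ℓ) (r : ℕ) →
    let G = IncomparabilityGraph P in
    ( (IsInitialSegment P X → IsInitialSegment P (BallAround G X r))
    × (IsFinalSegment P X → IsFinalSegment P (BallAround G X r))
    × (IsOrderConvex P X → IsOrderConvex P (BallAround G X r))
    × (∀ x s → IsOrderConvex P (Ball G x s)) )
    × ( IsOrderConvex P X → 1 ≤ r →
    IsIsometric G (BallAround G X r)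
    × ((∃[ v ] X ⊆ Component G v) → Connected (Induced G (BallAround G X r))) )
theorem7 {c} {ℓ₁} {ℓ₂} {ℓ} em P X r =
    ( ball-initial P em′ , ball-final P em′ , ball-convex P em′
    , ball-point-convex P em′ )
  , λ convex 1≤r →
      let restrict : WalksRestrict G B
          restrict = convex⇒walksRestrict
            (incomparabilityGraph P (excludedMiddle-lower (c ⊔ ℓ₁) em′))
            (ball-convex P em′ convex) (ball-inner P em′ 1≤r)
      in  walksRestrict⇒isometric em restrict
        , λ (v , X⊆Cv) (x , x∈B) (y , y∈B) →
            let a , a∈X , d = x∈B
                b , b∈X , e = y∈B
                va = path⇒walk (proj₂ (X⊆Cv a∈X))
                vb = path⇒walk (proj₂ (X⊆Cv b∈X))
                -- The route in `G` runs from `x` via `a`, `v` and `b` to `y`; `restrict` then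
                -- brings it into the ball.
                w  = distanceAtMost⇒walk d ++
                     (reverse va ++ (vb ++ reverse (distanceAtMost⇒walk e)))
                n , _ , path , _ = walk⇒distance em _ (restrict x∈B y∈B _ w)
            in  n , path
  where
  em′ : ExcludedMiddle (c ⊔ ℓ₁ ⊔ ℓ₂)
  em′ = excludedMiddle-lower ℓ em
  G = IncomparabilityGraph P
  B = BallAround G X r
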